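{- For every set $\Gamma\subseteq\mathbf{PL}$ and every formula $\alpha\in\mathbf{PL}$: $\Gamma\Vdash\alpha$ if and only if $\mathsf{Kh}\Gamma\vDash\mathsf{Kh}\alpha$, where $\mathsf{Kh}\Gamma=\{\mathsf{Kh}\gamma\mid\gamma\in\Gamma\}$, $\Vdash$ is entailment in inquisitive (support) semantics, and $\vDash$ is entailment in the know-how semantics over pointed models.
   Context: Fix a countable set $\mathbf{P}$ of proposition letters. $\mathbf{PL}$ is the set of formulas $\alpha::=p\mid\bot\mid(\alpha\land\alpha)\mid(\alpha\lor\alpha)\mid(\alpha\to\alpha)$ with $p\in\mathbf{P}$. A model is $M=\langle W,V\rangle$ with $W$ a non-empty set (of worlds) and $V:W\to\wp(\mathbf{P})$. Inquisitive semantics. A state in $M$ is any subset $s\subseteq W$ (possibly empty). Support $M,s\Vdash\alpha$ is defined by: $M,s\Vdash p$ iff $p\in V(w)$ for all $w\in s$; $M,s\Vdash\bot$ iff $s=\varnothing$; $M,s\Vdash\alpha\land\beta$ iff $M,s\Vdash\alpha$ and $M,s\Vdash\beta$; $M,s\Vdash\alpha\lor\beta$ iff $M,s\Vdash\alpha$ or $M,s\Vdash\beta$; $M,s\Vdash\alpha\to\beta$ iff for all $t\subseteq s$, $M,t\Vdash\alpha$ implies $M,t\Vdash\beta$. $\Gamma\Vdash\alpha$ means: for every model $M$ and state $s$ in $M$, if $M,s\Vdash\gamma$ for all $\gamma\in\Gamma$ then $M,s\Vdash\alpha$. Know-how semantics. The resolution space $S(\alpha)$ is defined by: $S(p)=\{p\}$;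 $S(\bot)=\{\bot\}$; $S(\alpha\lor\beta)=(S(\alpha)\times\{0\})\cup(S(\beta)\times\{1\})$; $S(\alpha\land\beta)=S(\alpha)\times S(\beta)$; $S(\alpha\to\beta)=S(\beta)^{S(\alpha)}$ (all functions from $S(\alpha)$ to $S(\beta)$). For a world $w$ of $M$, the set of actual resolutions $R(w,\alpha)\subseteq S(\alpha)$ is: $R(w,\bot)=\varnothing$; $R(w,p)=\{p\}$ if $p\in V(w)$ and $\varnothing$ otherwise; $R(w,\alpha\lor\beta)=(R(w,\alpha)\times\{0\})\cup(R(w,\beta)\times\{1\})$; $R(w,\alpha\land\beta)=R(w,\alpha)\times R(w,\beta)$; $R(w,\alpha\to\beta)=\{f\in S(\beta)^{S(\alpha)}\mid f[R(w,\alpha)]\subseteq R(w,\beta)\}$. For $w\in W$: $M,w\vDash\mathsf{Kh}\alpha$ iff there is $x\in S(\alpha)$ such that $x\in R(v,\alpha)$ for all $v\in W$. $\mathsf{Kh}\Gamma\vDash\mathsf{Kh}\alpha$ means: for every model $M$ and world $w$ of $M$, if $M,w\vDash\mathsf{Kh}\gamma$ for all $\gamma\in\Gamma$ then $M,w\vDash\mathsf{Kh}\alpha$. -}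

module Defs where

open import Data.Product using (∃; _×_)
open import Data.Sum using (_⊎_)
open import Level using (Lift; 0ℓ; suc)
open import Relation.Unary
  using (Pred; _∈_; _⊆_; ∅; ｛_｝; Empty; _⟨×⟩_; _⟨⊎⟩_; _⟨→⟩_)

infixr 7 _∧̇_
infixr 6 _∨̇_
infixr 5 _→̇_

data PL (P : Set) : Set where
  var  : P → PL P
  ⊥̇    : PL P
  _∧̇_  : PL P → PL P → PL P
  _∨̇_  : PL P → PL P → PL P
  _→̇_  : PL P → PL P → PL P

record Model (P : Set) : Set₁ where
  field
    W         : Set
    inhabited : W
    V         : W → Pred P 0ℓ

open Model public

State : {P : Set} → Model P → Set₁
State M = Pred (W M) 0ℓ

infix 4 _,_⊩_ _⊩_ _,_⊨Kh_ Kh_⊨Kh_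

-- The implication clause quantifies over all substates, so support lives in
-- Set₁; Lift only adjusts the universe of the two base clauses.
_,_⊩_ : {P : Set} (M : Model P) → State M → PL P → Set₁
M , s ⊩ var p  = Lift (suc 0ℓ) (∀ w → w ∈ s → p ∈ V M w)
M , s ⊩ ⊥̇      = Lift (suc 0ℓ) (Empty s)
M , s ⊩ α ∧̇ β  = (M , s ⊩ α) × (M , s ⊩ β)
M , s ⊩ α ∨̇ β  = (M , s ⊩ α) ⊎ (M , s ⊩ β)
M , s ⊩ α →̇ β  = (t : State M) → t ⊆ s → M , t ⊩ α → M , t ⊩ β

_⊩_ : {P : Set} → Pred (PL P) 0ℓ → PL P → Set₁
_⊩_ {P} Γ α =
  (M : Model P) (s : State M) → (∀ γ → γ ∈ Γ → M , s ⊩ γ) → M , s ⊩ α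

-- ∃ ｛ a ｝ is the one-element set {a}, and the disjoint sum ⊎ plays the role
-- of tagging with 0 and 1.
S : {P : Set} → PL P → Set
S (var p)  = ∃ ｛ p ｝
S {P} ⊥̇    = ∃ ｛ ⊥̇ {P} ｝
S (α ∧̇ β)  = S α × S β
S (α ∨̇ β)  = S α ⊎ S β
S (α →̇ β)  = S α → S β

-- In the last clause, f ∈ (A ⟨→⟩ B) unfolds to A ⊆ B ∘ f, that is, f[A] ⊆ B.
R : {P : Set} (M : Model P) → W M → (α : PL P) → Pred (S α) 0ℓ
R M w (var p)  = λ _ → p ∈ V M w
R M w ⊥̇        = ∅
R M w (α ∧̇ β)  = R M w α ⟨×⟩ R M w β
R M w (α ∨̇ β)  = R M w α ⟨⊎⟩ R M w β
R M w (α →̇ β)  = R M w α ⟨→⟩ R M w β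

-- Kh is a global modality: its truth does not depend on the evaluation world.
_,_⊨Kh_ : {P : Set} (M : Model P) → W M → PL P → Set
M , w ⊨Kh α = ∃ λ (x : S α) → ∀ v → x ∈ R M v α

-- Kh Γ ⊨Kh α is the entailment from {Kh γ ∣ γ ∈ Γ} to Kh α.
Kh_⊨Kh_ : {P : Set} → Pred (PL P) 0ℓ → PL P → Set₁
Kh_⊨Kh_ {P} Γ α =
  (M : Model P) (w : W M) → (∀ γ → γ ∈ Γ → M , w ⊨Kh γ) → M , w ⊨Kh α

{-# OPTIONS --safe #-}

-- A state supports α iff some single resolution of α is actual throughout it
-- (a uniform resolution).  For an implication α →̇ β, apply support to the
-- substates {w ∈ s ∣ x ∈ R(w,α)}, one for each x ∈ S(α): the uniform
-- resolutions of β obtained there assemble into a function.  Kh α thus says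
-- that the full state supports α, and conversely every non-empty state is the
-- full state of the submodel it carves out.
module Submission where

open import Defs
open import Axiom.ExcludedMiddle using (ExcludedMiddle)
open import Data.Empty using (⊥-elim)
open import Data.Nat using (ℕ)
open import Data.Product using (∃; _,_; proj₁; proj₂)
open import Data.Sum using (inj₁; inj₂)
open import Function.Base using (_∘_)
open import Function.Bundles using (_↣_; _⇔_; mk⇔)
open import Level using (0ℓ; lift; lower)
open import Relation.Binary.PropositionalEquality
  using (_≡_; refl; sym; cong₂; subst)
open import Relation.Nullary using (yes; no)
open import Relation.Unary
  using (Pred; _∈_; _∩_; U; Empty; _⟨×⟩_; _⟨⊎⟩_; _⟨→⟩_)

private variable
  P : Set

UniformResolution : (M : Model P) → State M → PL P → Set
UniformResolution M s α = ∃ λ (x : S α) → ∀ v → v ∈ s → x ∈ R M v α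

module _ (M : Model P) where

  -- Both directions go by one simultaneous induction on the formula, for all states at once:
  -- implication is contravariant in its antecedent, so each direction at `α →̇ β` calls the other
  -- at `α`.
  support⇒resolution : ∀ α (s : State M) → M , s ⊩ α → UniformResolution M s α
  resolution⇒support : ∀ α (s : State M) → UniformResolution M s α → M , s ⊩ α

  support⇒resolution (var p) s h = (p , refl) , lower h
  support⇒resolution ⊥̇ s h = (⊥̇ , refl) , lower h
  support⇒resolution (α ∧̇ β) s (h , k) =
    let x , x∈ = support⇒resolution α s h
        y , y∈ = support⇒resolution β s k
    in (x , y) , λ v v∈s → x∈ v v∈s , y∈ v v∈s
  support⇒resolution (α ∨̇ β) s (inj₁ h) =
    let x , x∈ = support⇒resolution α s h in inj₁ x , x∈
  support⇒resolution (α ∨̇ β) s (inj₂ k) =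
    let y , y∈ = support⇒resolution β s k in inj₂ y , y∈
  support⇒resolution (α →̇ β) s h =
    -- `image` is total on `S α`: an `x` actual nowhere in `s` merely yields the empty substate. A
    -- world where `x` is actual lies in the substate of `x`, so the value chosen there is actual
    -- too.
    proj₁ ∘ image , λ v v∈s {x} x∈R → proj₂ (image x) v (v∈s , x∈R)
    where
    image : ∀ x → UniformResolution M (s ∩ λ v → x ∈ R M v α) β
    image x = support⇒resolution β _
      (h _ proj₁ (resolution⇒support α _ (x , λ _ → proj₂)))

  resolution⇒support (var p) s (_ , x∈) = lift x∈
  resolution⇒support ⊥̇ s (_ , x∈) = lift x∈
  resolution⇒support (α ∧̇ β) s ((x , y) , xy∈) =
    resolution⇒support α s (x , λ v → proj₁ ∘ xy∈ v) ,
    resolution⇒support β s (y , λ v → proj₂ ∘ xy∈ v)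
  resolution⇒support (α ∨̇ β) s (inj₁ x , x∈) =
    inj₁ (resolution⇒support α s (x , x∈))
  resolution⇒support (α ∨̇ β) s (inj₂ y , y∈) =
    inj₂ (resolution⇒support β s (y , y∈))
  resolution⇒support (α →̇ β) s (f , f∈) t t⊆s h =
    let x , x∈ = support⇒resolution α t h
    in resolution⇒support β t (f x , λ v v∈t → f∈ v (t⊆s v∈t) (x∈ v v∈t))

-- Unlike `R`, the space `S` is never empty, not even at `⊥̇`; so the empty state has a uniform
-- resolution, vacuously.
S-inhabited : (α : PL P) → S α
S-inhabited (var p)  = p , refl
S-inhabited ⊥̇        = ⊥̇ , refl
S-inhabited (α ∧̇ β)  = S-inhabited α , S-inhabited β
S-inhabited (α ∨̇ β)  = inj₁ (S-inhabited α)
S-inhabited (α →̇ β)  = λ _ → S-inhabited β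

empty-supports : (M : Model P) (s : State M) → Empty s → ∀ α → M , s ⊩ α
empty-supports M s s-empty α =
  resolution⇒support M α s (S-inhabited α , λ v v∈s → ⊥-elim (s-empty v v∈s))

restrict : (M : Model P) (s : State M) → ∃ s → Model P
restrict M s w = record { W = ∃ s ; inhabited = w ; V = V M ∘ proj₁ }

-- `R` consults only the valuation at the given world, which restriction preserves, and `S` does not
-- mention the model.
R-restrict : (M : Model P) (s : State M) (w v : ∃ s) (α : PL P) →
  R (restrict M s w) v α ≡ R M (proj₁ v) α
R-restrict M s w v (var p)  = refl
R-restrict M s w v ⊥̇        = refl
R-restrict M s w v (α ∧̇ β)  =
  cong₂ _⟨×⟩_ (R-restrict M s w v α) (R-restrict M s w v β)
R-restrict M s w v (α ∨̇ β)  =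
  cong₂ _⟨⊎⟩_ (R-restrict M s w v α) (R-restrict M s w v β)
R-restrict M s w v (α →̇ β)  =
  cong₂ _⟨→⟩_ (R-restrict M s w v α) (R-restrict M s w v β)

⊩⇒Kh : {Γ : Pred (PL P) 0ℓ} {α : PL P} → Γ ⊩ α → Kh Γ ⊨Kh α
⊩⇒Kh {α = α} Γ⊩α M w KhΓ =
  let x , x∈ = support⇒resolution M α U (Γ⊩α M U λ γ γ∈Γ →
                 let y , y∈ = KhΓ γ γ∈Γ
                 in resolution⇒support M γ U (y , λ v _ → y∈ v))
  in x , λ v → x∈ v _

Kh⇒⊩ : ExcludedMiddle 0ℓ → {Γ : Pred (PL P) 0ℓ} {α : PL P} →
  Kh Γ ⊨Kh α → Γ ⊩ α
Kh⇒⊩ em {α = α} KhΓ⊨Khα M s s⊩Γ with em {∃ s}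
-- A model must have a world, so the empty state carves out no submodel and is settled separately.
... | no s-empty = empty-supports M s (λ v v∈s → s-empty (v , v∈s)) α
... | yes w =
  let x , x∈ = KhΓ⊨Khα (restrict M s w) w λ γ γ∈Γ →
        let y , y∈ = support⇒resolution M γ s (s⊩Γ γ γ∈Γ)
        in y , λ (v , v∈s) →
          subst (y ∈_) (sym (R-restrict M s w (v , v∈s) γ)) (y∈ v v∈s)
  in resolution⇒support M α s
       (x , λ v v∈s → subst (x ∈_) (R-restrict M s w (v , v∈s) α) (x∈ (v , v∈s)))

theorem35 : ExcludedMiddle 0ℓ → (P : Set) → P ↣ ℕ →
    (Γ : Pred (PL P) 0ℓ) (α : PL P) → (Γ ⊩ α) ⇔ (Kh Γ ⊨Kh α)
theorem35 em P _ Γ α = mk⇔ ⊩⇒Kh (Kh⇒⊩ em)
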